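{- Let $n > k \geq 1$ be integers. If $\mathcal{F}$ is a $k$-pseudotree on an $n$-element set $X$, then $|\mathcal{F}| \leq (k+1)n - \frac{(k+1)k}{2}$. This bound is best possible: for all integers $n > k \geq 1$ there is a $k$-pseudotree on an $n$-element set with exactly $(k+1)n - \frac{(k+1)k}{2}$ members.
   Context: All sets are finite. Let $\mathcal{F}$ be a family (set) of subsets of a set $X$, partially ordered by inclusion. The center of $A \subseteq X$ (with respect to $\mathcal{F}$) is $\mathrm{C}(A) = \{x \in A \mid \text{for every } U \in \mathcal{F} \text{ with } x \in U,\ U \subseteq A \text{ or } A \subseteq U\}$. The family $\mathcal{F}$ is centered iff $\mathrm{C}(U) \neq \emptyset$ for every $U \in \mathcal{F}$. The family $\mathcal{F}$ is locally $k$-wide iff for every $x \in X$ every antichain (with respect to inclusion) of $\{U \in \mathcal{F} \mid x \in U\}$ has at most $k$ members. The family $\mathcal{F}$ is a $k$-pseudotree on $X$ iff $\mathcal{F}$ is centered, locally $k$-wide, $X \in \mathcal{F}$, and $\{x\} \in \mathcal{F}$ for every $x \in X$. -}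

module Defs where

open import Data.Fin.Base using (Fin)
open import Data.Fin.Subset using (Subset; _∈_; _⊆_; ⊤; ⁅_⁆)
open import Data.List.Base using (List; length)
open import Data.List.Membership.Propositional using () renaming (_∈_ to _∈ˡ_)
open import Data.List.Relation.Unary.Unique.Propositional using (Unique)
open import Data.Nat.Base using (ℕ; _≤_; _+_; _*_; _∸_; _/_)
open import Data.Product.Base using (_×_)
open import Data.Sum.Base using (_⊎_)
open import Level using (0ℓ)
open import Relation.Binary.PropositionalEquality.Core using (_≡_)
open import Relation.Unary using (Pred; Satisfiable)

-- The n-element ground set X is Fin n.  A family of subsets of X is listed
-- without repetition, so that its cardinality is the length of the list.
record Family (n : ℕ) : Set where
  field
    members : List (Subset n)
    unique  : Unique members

open Family public

infix 4 _∈ᶠ_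

_∈ᶠ_ : ∀ {n} → Subset n → Family n → Set
U ∈ᶠ F = U ∈ˡ members F

size : ∀ {n} → Family n → ℕ
size F = length (members F)

Center : ∀ {n} → Family n → Subset n → Pred (Fin n) 0ℓ
Center F A x = x ∈ A × (∀ U → U ∈ᶠ F → x ∈ U → U ⊆ A ⊎ A ⊆ U)

Centered : ∀ {n} → Family n → Set
Centered F = ∀ U → U ∈ᶠ F → Satisfiable (Center F U)

Antichain : ∀ {n} → Family n → Set
Antichain G = ∀ U V → U ∈ᶠ G → V ∈ᶠ G → U ⊆ V → U ≡ V

LocallyWide : ∀ {n} → ℕ → Family n → Set
LocallyWide {n} k F =
  ∀ (x : Fin n) (G : Family n) →
  (∀ U → U ∈ᶠ G → U ∈ᶠ F × x ∈ U) →
  Antichain G → size G ≤ k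

record IsPseudotree {n : ℕ} (k : ℕ) (F : Family n) : Set where
  field
    centered    : Centered F
    locallyWide : LocallyWide k F
    whole       : ⊤ ∈ᶠ F
    singletons  : ∀ x → ⁅ x ⁆ ∈ᶠ F

-- Neither operation rounds when k < n: (k + 1) * k is even, and
-- (k + 1) * k / 2 ≤ (k + 1) * n, so _∸_ is ordinary subtraction.
bound : ℕ → ℕ → ℕ
bound n k = ((k + 1) * n) ∸ (((k + 1) * k) / 2)

{-# OPTIONS --safe #-}
-- Upper bound.  Call x removable if every member with an element besides x also
-- has a center besides x.  Removing such an x from X keeps the family centered
-- and locally k-wide, and the members lost are {x} together with those
-- W ∋ x for which W \ {x} is a member too.  The latter form an antichain with
-- distinct centers besides x, so there are at most min(k, n - 1) of them, and
-- |F| ≤ Σ_{i<n} (1 + min(i, k)).  A removable element exists: if x is the only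
-- center of A and y ∈ A \ {x} is not removable, then y is the only center of some B;
-- A and B are comparable, A ⊆ B would make x a center of B, so B is smaller than A.
--
-- Lower bound.  On a linearly ordered X take the singletons {i} and the sets
-- {i} ∪ {t | t > i + d} with 0 ≤ d < k.  Minima are centers, and the minima of an
-- antichain of members through a common point lie in a window of length k.
module Submission where

open import Defs
open import Data.Bool.Properties using () renaming (_≟_ to _≟ᵇ_)
open import Data.Empty using (⊥-elim) renaming (⊥ to ⊥′)
open import Data.Fin.Base as Fin using (Fin; zero; suc; toℕ; punchIn; punchOut; fromℕ<)
open import Data.Fin.Properties as Fin
  using (any?; injective⇒≤; punchIn-punchOut; toℕ-injective; toℕ-fromℕ<)
open import Data.Fin.Subset
  using (Subset; _∈_; _∉_; _⊆_; _⊂_; _-_; ∣_∣; ⊤; ⊥; ⁅_⁆; inside; outside)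
open import Data.Fin.Subset.Properties
  using (_∈?_; _⊆?_; ⊆-antisym; ⊆-reflexive; ⊆-trans; ⊆⊤; ∈⊤; ∉⊥; x∈⁅x⁆; x∈⁅y⁆⇒x≡y;
         p─q⊆p; x∈p∧x≢y⇒x∈p-y; p⊂q⇒∣p∣<∣q∣; s⊆s; out⊆)
open import Data.List.Base using (List; []; _∷_; [_]; _++_; map; filter; length; lookup)
open import Data.List.Membership.Propositional using (find) renaming (_∈_ to _∈ˡ_)
open import Data.List.Membership.Propositional.Properties
  using (∈-map⁺; ∈-map⁻; ∈-++⁺ˡ; ∈-++⁺ʳ; ∈-++⁻; ∈-filter⁺; ∈-filter⁻; ∈-lookup)
import Data.List.Membership.DecPropositional as DecMembership
open import Data.List.Properties using (length-++; length-map)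
open import Data.List.Relation.Unary.All as All using (All; []; _∷_)
open import Data.List.Relation.Unary.All.Properties using (¬All⇒Any¬)
open import Data.List.Relation.Unary.AllPairs using ([]; _∷_)
open import Data.List.Relation.Unary.Any as Any using (here; there)
open import Data.List.Relation.Unary.Any.Properties using (lookup-index)
open import Data.List.Relation.Unary.Unique.Propositional using (Unique)
open import Data.List.Relation.Unary.Unique.Propositional.Properties as Unique using (filter⁺)
open import Data.Nat.Base
  using (ℕ; zero; suc; _≤_; _<_; _+_; _*_; _∸_; _⊓_; _/_; _%_; NonZero; z≤n; s≤s)
open import Data.Nat.DivMod using (m*n/n≡m; m≡m%n+[m/n]*n; m%n<n)
open import Data.Nat.Induction using (<-wellFounded)
open import Data.Nat.Properties
open import Data.Nat.Solver using (module +-*-Solver)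
open import Data.Product.Base using (_×_; _,_; proj₁; proj₂; ∃; ∃-syntax)
open import Data.Sum.Base as Sum using (_⊎_; inj₁; inj₂; [_,_]′)
open import Data.Vec.Base using ([]; _∷_; removeAt) renaming (here to hereᵛ; there to thereᵛ)
open import Data.Vec.Properties using (≡-dec; ∷-injectiveʳ)
open import Function.Base using (_∘_; id)
open import Induction.WellFounded using (Acc; acc)
open import Relation.Binary.Definitions using (tri<; tri≈; tri>)
open import Relation.Binary.PropositionalEquality
  using (_≡_; _≢_; refl; sym; trans; cong; cong₂; subst; module ≡-Reasoning)
open import Relation.Nullary using (¬_; Dec; yes; no; contradiction; ¬?; _×-dec_; _⊎-dec_; _→-dec_)
open import Relation.Nullary.Decidable using (map′; decidable-stable)

-- Counting entries of lists without repetition.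

unique-lookup-injective : ∀ {A : Set} {xs : List A} → Unique xs →
  ∀ i j → lookup xs i ≡ lookup xs j → i ≡ j
unique-lookup-injective (_ ∷ _) zero zero _ = refl
unique-lookup-injective (x∉ ∷ _) zero (suc j) eq = contradiction eq (All.lookup x∉ (∈-lookup j))
unique-lookup-injective (x∉ ∷ _) (suc i) zero eq = contradiction (sym eq) (All.lookup x∉ (∈-lookup i))
unique-lookup-injective (_ ∷ uniq) (suc i) (suc j) eq = cong suc (unique-lookup-injective uniq i j eq)

-- Choosing one label per position gives an injection into `Fin m`. A relation `R` serves where an
-- entry merely has some label, such as a center or the residue of a minimum.
unique-length≤ : ∀ {A : Set} {m} {xs : List A} (R : A → Fin m → Set) → Unique xs →
  (∀ {a} → a ∈ˡ xs → ∃ (R a)) →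
  (∀ {a b i} → a ∈ˡ xs → b ∈ˡ xs → R a i → R b i → a ≡ b) →
  length xs ≤ m
unique-length≤ {xs = xs} R uniq total inj = injective⇒≤ {f = label} label-injective
  where
  label : Fin (length xs) → _
  label i = proj₁ (total (∈-lookup {xs = xs} i))

  label-injective : ∀ {i j} → label i ≡ label j → i ≡ j
  label-injective {i} {j} eq = unique-lookup-injective uniq i j
    (inj (∈-lookup i) (∈-lookup j) (proj₂ (total (∈-lookup i)))
      (subst (R _) (sym eq) (proj₂ (total (∈-lookup j)))))

unique-⊆-length≤ : ∀ {A : Set} {xs ys : List A} → Unique xs →
  (∀ {a} → a ∈ˡ xs → a ∈ˡ ys) → length xs ≤ length ys
unique-⊆-length≤ {ys = ys} uniq sub = unique-length≤ (λ a i → a ≡ lookup ys i) uniq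
  (λ a∈ → Any.index (sub a∈) , lookup-index (sub a∈)) (λ _ _ p q → trans p (sym q))

-- Injectivity is asked only on the listed entries, because deleting a point is injective on the
-- sets in `kept` but not on all subsets.
unique-map⁺ : ∀ {A B : Set} {f : A → B} {xs} →
  (∀ {a b} → a ∈ˡ xs → b ∈ˡ xs → f a ≡ f b → a ≡ b) → Unique xs → Unique (map f xs)
unique-map⁺ inj [] = []
unique-map⁺ {f = f} {x ∷ xs} inj (x∉ ∷ uniq) =
  All.tabulate fresh ∷ unique-map⁺ (λ a b → inj (there a) (there b)) uniq
  where
  fresh : ∀ {b} → b ∈ˡ map f xs → f x ≢ b
  fresh b∈ eq with y , y∈ , refl ← ∈-map⁻ f b∈ =
    All.lookup x∉ y∈ (inj (here refl) (there y∈) eq)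

-- Deleting a point from a subset.

∈-removeAt⁺ : ∀ {n} (U : Subset (suc n)) x {y} → punchIn x y ∈ U → y ∈ removeAt U x
∈-removeAt⁺ (_ ∷ _)     zero            (thereᵛ p) = p
∈-removeAt⁺ (_ ∷ _ ∷ _) (suc x) {zero}  hereᵛ      = hereᵛ
∈-removeAt⁺ (_ ∷ _ ∷ _) (suc x) {suc y} (thereᵛ p) = thereᵛ (∈-removeAt⁺ _ x p)

∈-removeAt⁻ : ∀ {n} (U : Subset (suc n)) x {y} → y ∈ removeAt U x → punchIn x y ∈ U
∈-removeAt⁻ (_ ∷ _)     zero            p          = thereᵛ p
∈-removeAt⁻ (_ ∷ _ ∷ _) (suc x) {zero}  hereᵛ      = hereᵛ
∈-removeAt⁻ (_ ∷ _ ∷ _) (suc x) {suc y} (thereᵛ p) = thereᵛ (∈-removeAt⁻ _ x p)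

removeAt-⊆⁺ : ∀ {n} (U V : Subset (suc n)) x → U ⊆ V → removeAt U x ⊆ removeAt V x
removeAt-⊆⁺ U V x U⊆V y∈ = ∈-removeAt⁺ V x (U⊆V (∈-removeAt⁻ U x y∈))

removeAt-⊆⁻ : ∀ {n} (U V : Subset (suc n)) x → removeAt U x ⊆ removeAt V x →
  ∀ {y} → y ≢ x → y ∈ U → y ∈ V
removeAt-⊆⁻ U V x sub y≢x y∈U = subst (_∈ V) eq
  (∈-removeAt⁻ V x (sub (∈-removeAt⁺ U x (subst (_∈ U) (sym eq) y∈U))))
  where
  eq = punchIn-punchOut (y≢x ∘ sym)

x∉p-x : ∀ {n} (U : Subset n) x → x ∉ U - x
x∉p-x (_ ∷ U) zero    ()
x∉p-x (_ ∷ U) (suc x) (thereᵛ p) = x∉p-x U x p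

⊆∧⊈⇒⊂ : ∀ {n} {U V : Subset n} → U ⊆ V → ¬ V ⊆ U → U ⊂ V
⊆∧⊈⇒⊂ {U = U} {V} U⊆V V⊈U = U⊆V , decidable-stable
  (any? λ x → (x ∈? V) ×-dec ¬? (x ∈? U))
  (λ none → V⊈U λ {x} x∈V → decidable-stable (x ∈? U) λ x∉U → none (x , x∈V , x∉U))

-- The summand `suc (n ⊓ k)` bounds the loss when one of `suc n` points is deleted, and counts the
-- sets gained when the extremal family receives a new least point. Both halves of the theorem meet
-- in this sum.
total : ℕ → ℕ → ℕ
total zero    k = 0
total (suc n) k = total n k + suc (n ⊓ k)

-- Existence of a removable point.

module _ {n} (F : Family n) where

  center? : ∀ U x → Dec (Center F U x)
  center? U x = (x ∈? U) ×-dec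
    map′ (λ p V V∈ → All.lookup p V∈) (λ q → All.tabulate λ {V} V∈ → q V V∈)
      (All.all? (λ V → (x ∈? V) →-dec ((V ⊆? U) ⊎-dec (U ⊆? V))) (members F))

  Other : Fin n → (Fin n → Set) → Set
  Other x P = ∃ λ y → y ≢ x × P y

  Spares : Fin n → Subset n → Set
  Spares x U = Other x (_∈ U) → Other x (Center F U)

  Removable : Fin n → Set
  Removable x = All (Spares x) (members F)

  other? : ∀ x {P : Fin n → Set} → (∀ y → Dec (P y)) → Dec (Other x P)
  other? x P? = any? λ y → ¬? (y Fin.≟ x) ×-dec P? y

  spares? : ∀ x U → Dec (Spares x U)
  spares? x U = other? x (_∈? U) →-dec other? x (center? U)

  module _ (centered : Centered F) where

    -- The witness that `x` is not removable; its last component supplies the next point of the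
    -- descent.
    SoleCenter : Subset n → Fin n → Set
    SoleCenter A x = A ∈ᶠ F × Center F A x × (∀ z → Center F A z → z ≡ x) × Other x (_∈ A)

    ¬spares⇒soleCenter : ∀ {A x} → A ∈ᶠ F → ¬ Spares x A → SoleCenter A x
    ¬spares⇒soleCenter {A} {x} A∈F ¬sp with centered A A∈F
    ... | c , c-center = A∈F , subst (Center F A) (only c c-center) c-center , only ,
      decidable-stable (other? x (_∈? A)) (λ ¬o → ¬sp λ o → contradiction o ¬o)
      where
      only : ∀ z → Center F A z → z ≡ x
      only z z-center = decidable-stable (z Fin.≟ x) (λ z≢x → ¬sp λ _ → z , z≢x , z-center)

    removable⊎soleCenter : ∀ x → Removable x ⊎ ∃ λ A → SoleCenter A x
    removable⊎soleCenter x with All.all? (spares? x) (members F)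
    ... | yes r = inj₁ r
    ... | no ¬r with A , A∈F , ¬sp ← find (¬All⇒Any¬ (spares? x) (members F) ¬r) =
      inj₂ (A , ¬spares⇒soleCenter A∈F ¬sp)

    -- If `A ⊆ B`, a member through `x` either lies in `A`, hence in `B`, or contains `A` and so
    -- `y`, which makes it comparable with `B`. Then `x` would be a second center of `B`.
    soleCenter-⊈ : ∀ {A B x y} → SoleCenter A x → SoleCenter B y → y ∈ A → y ≢ x → ¬ A ⊆ B
    soleCenter-⊈ {A} {B} {x} (_ , (x∈A , xA) , _) (_ , (_ , yB) , onlyB , _) y∈A y≢x A⊆B =
      y≢x (sym (onlyB x (A⊆B x∈A , cmp)))
      where
      cmp : ∀ U → U ∈ᶠ F → x ∈ U → U ⊆ B ⊎ B ⊆ U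
      cmp U U∈F x∈U with xA U U∈F x∈U
      ... | inj₁ U⊆A = inj₁ (⊆-trans U⊆A A⊆B)
      ... | inj₂ A⊆U = yB U U∈F (A⊆U y∈A)

    soleCenter-⊂ : ∀ {A B x y} → SoleCenter A x → SoleCenter B y → y ∈ A → y ≢ x → B ⊂ A
    soleCenter-⊂ {A} soleA@(A∈F , _) soleB@(_ , (_ , yB) , _) y∈A y≢x with yB A A∈F y∈A
    ... | inj₁ A⊆B = ⊥-elim (soleCenter-⊈ soleA soleB y∈A y≢x A⊆B)
    ... | inj₂ B⊆A = ⊆∧⊈⇒⊂ B⊆A (soleCenter-⊈ soleA soleB y∈A y≢x)

    removable-below : ∀ {A x} → SoleCenter A x → Acc _<_ ∣ A ∣ → ∃ Removable
    removable-below {A} soleA@(_ , _ , _ , y , y≢x , y∈A) (acc rec) with removable⊎soleCenter y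
    ... | inj₁ r = y , r
    ... | inj₂ (B , soleB) =
      removable-below soleB (rec (p⊂q⇒∣p∣<∣q∣ (soleCenter-⊂ soleA soleB y∈A y≢x)))

    ∃-removable : Fin n → ∃ Removable
    ∃-removable x with removable⊎soleCenter x
    ... | inj₁ r = x , r
    ... | inj₂ (_ , soleA) = removable-below soleA (<-wellFounded _)

-- Deleting a removable point.

module Removal {n k} (F : Family (suc n)) (centered : Centered F) (wide : LocallyWide k F)
  {x} (removable : Removable F x) where

  open DecMembership (≡-dec {n = suc n} _≟ᵇ_) using () renaming (_∈?_ to _∈ˡ?_)

  spares : ∀ {U} → U ∈ᶠ F → Spares F x U
  spares = All.lookup removable

  Twin : Subset (suc n) → Set
  Twin U = x ∈ U × (U - x) ∈ᶠ F

  twin? : ∀ U → Dec (Twin U)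
  twin? U = (x ∈? U) ×-dec ((U - x) ∈ˡ? members F)

  -- Of a pair `W`, `W - x` with a common trace off `x`, the smaller set stays. The set `⁅ x ⁆` goes
  -- because its trace is empty and could have no center.
  Kept : Subset (suc n) → Set
  Kept U = U ≢ ⁅ x ⁆ × ¬ Twin U

  kept? : ∀ U → Dec (Kept U)
  kept? U = ¬? (≡-dec _≟ᵇ_ U ⁅ x ⁆) ×-dec ¬? (twin? U)

  twins kept : List (Subset (suc n))
  twins = filter twin? (members F)
  kept  = filter kept? (members F)

  kept⁻ : ∀ {U} → U ∈ˡ kept → U ∈ᶠ F × Kept U
  kept⁻ = ∈-filter⁻ kept? {xs = members F}

  twins⁻ : ∀ {U} → U ∈ˡ twins → U ∈ᶠ F × Twin U
  twins⁻ = ∈-filter⁻ twin? {xs = members F}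

  size-split : size F ≤ length kept + suc (length twins)
  size-split = ≤-trans (unique-⊆-length≤ (unique F) classify)
    (≤-reflexive (length-++ kept))
    where
    classify : ∀ {U} → U ∈ᶠ F → U ∈ˡ kept ++ ⁅ x ⁆ ∷ twins
    classify {U} U∈F with ≡-dec _≟ᵇ_ U ⁅ x ⁆ | twin? U
    ... | yes U≡x | _      = ∈-++⁺ʳ kept (here U≡x)
    ... | no _    | yes t  = ∈-++⁺ʳ kept (there (∈-filter⁺ twin? U∈F t))
    ... | no U≢x  | no ¬t  = ∈-++⁺ˡ (∈-filter⁺ kept? U∈F (U≢x , ¬t))

  -- The member `W - x` has a center, so `W` has an element besides `x`, and removability turns this
  -- into a center besides `x`.
  twin-center : ∀ {W} → W ∈ᶠ F → Twin W → Other F x (Center F W)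
  twin-center {W} W∈F (_ , W-x∈F) with centered (W - x) W-x∈F
  ... | y , y∈ , _ = spares W∈F
    (y , (λ { refl → x∉p-x W x y∈ }) , p─q⊆p W ⁅ x ⁆ y∈)

  Twins : Family (suc n)
  Twins = record { members = twins ; unique = filter⁺ twin? (unique F) }

  -- A center `y` of `U` besides `x` lies in `V - x`, so `U` and `V - x` are comparable. As `x` is
  -- in `U`, only `V - x ⊆ U` is possible, and adding `x` gives `V ⊆ U`.
  twins-antichain : Antichain Twins
  twins-antichain U V U∈ V∈ U⊆V
    with U∈F , twinU@(x∈U , _) ← twins⁻ U∈ | V∈F , (x∈V , V-x∈F) ← twins⁻ V∈
    with y , y≢x , y∈U , yU ← twin-center U∈F twinU
    with yU (V - x) V-x∈F (x∈p∧x≢y⇒x∈p-y (U⊆V y∈U) y≢x)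
  ... | inj₂ U⊆V-x = contradiction (U⊆V-x x∈U) (x∉p-x V x)
  ... | inj₁ V-x⊆U = ⊆-antisym U⊆V V⊆U
    where
    V⊆U : V ⊆ U
    V⊆U {z} z∈V with z Fin.≟ x
    ... | yes refl = x∈U
    ... | no z≢x   = V-x⊆U (x∈p∧x≢y⇒x∈p-y z∈V z≢x)

  length-twins≤k : length twins ≤ k
  length-twins≤k = wide x Twins
    (λ U U∈ → proj₁ (twins⁻ U∈) , proj₁ (proj₂ (twins⁻ U∈))) twins-antichain

  -- Twins sharing a center are comparable, hence equal; the centers can be chosen among the `n`
  -- points besides `x`.
  length-twins≤n : length twins ≤ n
  length-twins≤n = unique-length≤ (λ W i → Center F W (punchIn x i)) (unique Twins)
    choose same
    where
    choose : ∀ {W} → W ∈ˡ twins → ∃ λ i → Center F W (punchIn x i)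
    choose {W} W∈ with W∈F , t ← twins⁻ W∈ with y , y≢x , c ← twin-center W∈F t =
      punchOut (y≢x ∘ sym) , subst (Center F W) (sym (punchIn-punchOut (y≢x ∘ sym))) c

    same : ∀ {U V i} → U ∈ˡ twins → V ∈ˡ twins →
      Center F U (punchIn x i) → Center F V (punchIn x i) → U ≡ V
    same {U} {V} U∈ V∈ (_ , cU) (y∈V , _) with cU V (proj₁ (twins⁻ V∈)) y∈V
    ... | inj₁ V⊆U = sym (twins-antichain V U V∈ U∈ V⊆U)
    ... | inj₂ U⊆V = twins-antichain U V U∈ V∈ U⊆V

  -- Sets with one trace differ at most in `x`. If `x` is in `U` but not in `V`, then `V` is
  -- `U - x`, and `U` would be a twin.
  removeAt-injective : ∀ {U V} → U ∈ˡ kept → V ∈ˡ kept → removeAt U x ≡ removeAt V x → U ≡ V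
  removeAt-injective U∈ V∈ eq = ⊆-antisym (sub U∈ V∈ eq) (sub V∈ U∈ (sym eq))
    where
    sub : ∀ {U V} → U ∈ˡ kept → V ∈ˡ kept → removeAt U x ≡ removeAt V x → U ⊆ V
    sub {U} {V} U∈ V∈ eq {z} z∈U with z Fin.≟ x
    ... | no z≢x = removeAt-⊆⁻ U V x (⊆-reflexive eq) z≢x z∈U
    ... | yes refl = decidable-stable (x ∈? V) λ x∉V → proj₂ (proj₂ (kept⁻ U∈))
      (z∈U , subst (_∈ᶠ F) (V≡U-x x∉V) (proj₁ (kept⁻ V∈)))
      where
      V≡U-x : x ∉ V → V ≡ U - x
      V≡U-x x∉V = ⊆-antisym
        (λ w∈V → let w≢x = λ { refl → x∉V w∈V } in
          x∈p∧x≢y⇒x∈p-y (removeAt-⊆⁻ V U x (⊆-reflexive (sym eq)) w≢x w∈V) w≢x)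
        (λ w∈ → removeAt-⊆⁻ U V x (⊆-reflexive eq) (λ { refl → x∉p-x U x w∈ })
          (p─q⊆p U ⁅ x ⁆ w∈))

  F′ : Family n
  F′ = record
    { members = map (λ U → removeAt U x) kept
    ; unique  = unique-map⁺ removeAt-injective (filter⁺ kept? (unique F))
    }

  -- If the center at hand is `x`, then `U ≢ ⁅ x ⁆` yields another element of `U`, and removability
  -- another center.
  kept-center : ∀ {U} → U ∈ˡ kept → Other F x (Center F U)
  kept-center {U} U∈ with U∈F , U≢x , _ ← kept⁻ U∈ with centered U U∈F
  ... | y , c@(y∈U , _) with y Fin.≟ x
  ...   | no y≢x   = y , y≢x , c
  ...   | yes refl = spares U∈F (decidable-stable (other? F x (_∈? U)) λ none →
    U≢x (⊆-antisym
      (λ {z} z∈U → subst (_∈ ⁅ x ⁆)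
        (sym (decidable-stable (z Fin.≟ x) λ z≢x → none (z , z≢x , z∈U))) (x∈⁅x⁆ x))
      (λ z∈ → subst (_∈ U) (sym (x∈⁅y⁆⇒x≡y x z∈)) y∈U)))

  centered′ : Centered F′
  centered′ _ ∈F′ with U , U∈ , refl ← ∈-map⁻ _ ∈F′ with y , y≢x , y∈U , yU ← kept-center U∈ =
    punchOut x≢y , ∈-removeAt⁺ U x (subst (_∈ U) (sym eq) y∈U) , cmp
    where
    x≢y = y≢x ∘ sym
    eq  = punchIn-punchOut x≢y

    cmp : ∀ V′ → V′ ∈ᶠ F′ → punchOut x≢y ∈ V′ → V′ ⊆ removeAt U x ⊎ removeAt U x ⊆ V′
    cmp _ ∈F′ y∈V′ with V , V∈ , refl ← ∈-map⁻ _ ∈F′ =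
      Sum.map (removeAt-⊆⁺ V U x) (removeAt-⊆⁺ U V x)
        (yU V (proj₁ (kept⁻ V∈)) (subst (_∈ V) eq (∈-removeAt⁻ V x y∈V′)))

  -- An antichain of traces lifts to one in `F`: inclusion passes to traces, where it forces
  -- equality, and equal traces come from equal kept sets.
  wide′ : LocallyWide k F′
  wide′ y G G-sub antichain = ≤-trans (unique-⊆-length≤ (unique G) covered)
    (≤-trans (≤-reflexive (length-map _ lift))
      (wide (punchIn x y) Lift lift-sub lift-antichain))
    where
    open DecMembership (≡-dec {n = n} _≟ᵇ_) using () renaming (_∈?_ to _∈ˡ?′_)

    inG? : ∀ U → Dec (removeAt U x ∈ᶠ G)
    inG? U = removeAt U x ∈ˡ?′ members G

    lift : List (Subset (suc n))
    lift = filter inG? kept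

    lift⁻ : ∀ {U} → U ∈ˡ lift → U ∈ˡ kept × removeAt U x ∈ᶠ G
    lift⁻ = ∈-filter⁻ inG? {xs = kept}

    covered : ∀ {V} → V ∈ᶠ G → V ∈ˡ map (λ U → removeAt U x) lift
    covered V∈G with U , U∈ , refl ← ∈-map⁻ _ (proj₁ (G-sub _ V∈G)) =
      ∈-map⁺ _ (∈-filter⁺ inG? U∈ V∈G)

    lift-sub : ∀ U → U ∈ˡ lift → U ∈ᶠ F × punchIn x y ∈ U
    lift-sub U U∈ = proj₁ (kept⁻ (proj₁ (lift⁻ U∈))) ,
      ∈-removeAt⁻ U x (proj₂ (G-sub _ (proj₂ (lift⁻ U∈))))

    Lift : Family (suc n)
    Lift = record { members = lift ; unique = filter⁺ inG? (filter⁺ kept? (unique F)) }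

    lift-antichain : Antichain Lift
    lift-antichain U V U∈ V∈ U⊆V = removeAt-injective (proj₁ (lift⁻ U∈)) (proj₁ (lift⁻ V∈))
      (antichain _ _ (proj₂ (lift⁻ U∈)) (proj₂ (lift⁻ V∈)) (removeAt-⊆⁺ U V x U⊆V))

-- The upper bound, by induction on the number of points.

size≤total : ∀ {n k} (F : Family n) → Centered F → LocallyWide k F → size F ≤ total n k
-- A member would need a center in `Fin zero`, so the family is empty.
size≤total {zero} F centered wide = unique-length≤ (λ _ _ → ⊥′) (unique F)
  (λ U∈F → contradiction (proj₁ (centered _ U∈F)) λ ()) (λ _ _ ())
size≤total {suc n} {k} F centered wide with x , removable ← ∃-removable F centered zero =
  begin
    size F ≤⟨ size-split ⟩
    length kept + suc (length twins) ≡⟨ cong (_+ suc (length twins)) (length-map _ kept) ⟨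
    size F′ + suc (length twins)
      -- The twins are bounded both by distinct centers and by local width, hence by the minimum of
      -- `n` and `k`.
      ≤⟨ +-mono-≤ (size≤total F′ centered′ wide′) (s≤s (⊓-glb length-twins≤n length-twins≤k)) ⟩
    total n k + suc (n ⊓ k) ∎
  where
  open Removal F centered wide removable
  open ≤-Reasoning

-- The extremal family and its size.

-- ⊥ and the final segments {t | t ≥ d} for d < k; those with d ≥ n are all ⊥, which is
-- listed once.
tails : ∀ (k n : ℕ) → List (Subset n)
tails (suc k) (suc n) = ⊤ ∷ map (outside ∷_) (tails k n)
tails _       _       = [ ⊥ ]

extremal : ∀ (k n : ℕ) → List (Subset n)
extremal k zero    = []
extremal k (suc n) = map (outside ∷_) (extremal k n) ++ map (inside ∷_) (tails k n)

∷-unique : ∀ {n s} {Us : List (Subset n)} → Unique Us → Unique (map (s ∷_) Us)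
∷-unique = Unique.map⁺ ∷-injectiveʳ

tails-unique : ∀ k n → Unique (tails k n)
tails-unique zero    n       = [] ∷ []
tails-unique (suc k) zero    = [] ∷ []
tails-unique (suc k) (suc n) = All.tabulate (λ V∈ → fresh (∈-map⁻ _ V∈)) ∷ ∷-unique (tails-unique k n)
  where
  fresh : ∀ {V} → (∃ λ U → U ∈ˡ tails k n × V ≡ outside ∷ U) → ⊤ ≢ V
  fresh (_ , _ , refl) ()

extremal-unique : ∀ k n → Unique (extremal k n)
extremal-unique k zero    = []
extremal-unique k (suc n) = Unique.++⁺ (∷-unique (extremal-unique k n)) (∷-unique (tails-unique k n))
  λ (p , q) → disjoint (∈-map⁻ _ p) (∈-map⁻ _ q)
  where
  disjoint : ∀ {V : Subset (suc n)} → (∃ λ U → U ∈ˡ extremal k n × V ≡ outside ∷ U) →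
    ¬ (∃ λ U → U ∈ˡ tails k n × V ≡ inside ∷ U)
  disjoint (_ , _ , refl) (_ , _ , ())

Extremal : ∀ k n → Family n
Extremal k n = record { members = extremal k n ; unique = extremal-unique k n }

length-tails : ∀ k n → length (tails k n) ≡ suc (n ⊓ k)
length-tails zero    n       = cong suc (sym (⊓-zeroʳ n))
length-tails (suc k) zero    = refl
length-tails (suc k) (suc n) = cong suc (trans (length-map _ (tails k n)) (length-tails k n))

size-Extremal : ∀ k n → size (Extremal k n) ≡ total n k
size-Extremal k zero    = refl
size-Extremal k (suc n) = trans (length-++ (map (outside ∷_) (extremal k n)))
  (cong₂ _+_ (trans (length-map _ (extremal k n)) (size-Extremal k n))
             (trans (length-map _ (tails k n)) (length-tails k n)))

⊥∈tails : ∀ k n → ⊥ ∈ˡ tails k n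
⊥∈tails zero    n       = here refl
⊥∈tails (suc k) zero    = here refl
⊥∈tails (suc k) (suc n) = there (∈-map⁺ _ (⊥∈tails k n))

⊤∈tails : ∀ k n → ⊤ ∈ˡ tails (suc k) n
⊤∈tails k zero    = here refl
⊤∈tails k (suc n) = here refl

tails-upClosed : ∀ k n {V x y} → V ∈ˡ tails k n → x Fin.≤ y → x ∈ V → y ∈ V
tails-upClosed zero    n       (here refl) _ x∈ = contradiction x∈ ∉⊥
tails-upClosed (suc k) (suc n) (here refl) _ _  = ∈⊤
tails-upClosed (suc k) (suc n) (there V∈) x≤y x∈ with ∈-map⁻ (outside ∷_) V∈
tails-upClosed (suc k) (suc n) {y = suc _} (there V∈) x≤y (thereᵛ x∈) | _ , U∈ , refl =
  thereᵛ (tails-upClosed k n U∈ (≤-pred x≤y) x∈)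

tails-total : ∀ k n {U V} → U ∈ˡ tails k n → V ∈ˡ tails k n → U ⊆ V ⊎ V ⊆ U
tails-total zero    n       (here refl) (here refl) = inj₁ id
tails-total (suc k) zero    (here refl) (here refl) = inj₁ id
tails-total (suc k) (suc n) (here refl) _           = inj₂ ⊆⊤
tails-total (suc k) (suc n) (there _)   (here refl) = inj₁ ⊆⊤
tails-total (suc k) (suc n) (there U∈)  (there V∈)
  with _ , U∈ , refl ← ∈-map⁻ (outside ∷_) U∈ | _ , V∈ , refl ← ∈-map⁻ (outside ∷_) V∈ =
  Sum.map s⊆s s⊆s (tails-total k n U∈ V∈)

-- The element `x` rules out `⊥`, so `V` is a final segment from some `d < k`, and a point outside
-- it is below `d`.
tails-gap : ∀ k n {V x y} → V ∈ˡ tails k n → x ∈ V → y ∉ V → suc (toℕ y) < k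
tails-gap zero    n       (here refl) x∈ _  = contradiction x∈ ∉⊥
tails-gap (suc k) (suc n) (here refl) _  y∉ = contradiction ∈⊤ y∉
tails-gap (suc k) (suc n) (there V∈)  x∈ y∉ with ∈-map⁻ (outside ∷_) V∈
tails-gap (suc zero) (suc n) (there V∈) (thereᵛ x∈) y∉ | _ , here refl , refl = contradiction x∈ ∉⊥
tails-gap (suc (suc k)) (suc n) {y = zero} (there V∈) x∈ y∉ | _ = s≤s (s≤s z≤n)
tails-gap (suc (suc k)) (suc n) {y = suc y} (there V∈) (thereᵛ x∈) y∉ | _ , U∈ , refl =
  s≤s (tails-gap (suc k) n U∈ x∈ (y∉ ∘ thereᵛ))

-- Minima of members: comparability and windows.

Min : ∀ {n} → Subset n → Fin n → Set
Min U x = x ∈ U × (∀ {y} → y ∈ U → x Fin.≤ y)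

min-∷ : ∀ {n} {U : Subset n} {x} → Min U x → Min (outside ∷ U) (suc x)
min-∷ (x∈ , x≤) = thereᵛ x∈ , λ { (thereᵛ y∈) → s≤s (x≤ y∈) }

min-drop : ∀ {n} {U : Subset n} {x} → Min (outside ∷ U) (suc x) → Min U x
min-drop (thereᵛ x∈ , x≤) = x∈ , λ y∈ → ≤-pred (x≤ (thereᵛ y∈))

-- The index carries the first bit, so matching tells whether the minimum is the new least point.
data View k n : Subset (suc n) → Set where
  old : ∀ {U} → U ∈ˡ extremal k n → View k n (outside ∷ U)
  new : ∀ {U} → U ∈ˡ tails k n → View k n (inside ∷ U)

view : ∀ k n {U} → U ∈ˡ extremal k (suc n) → View k n U
view k n U∈ with ∈-++⁻ (map (outside ∷_) (extremal k n)) U∈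
... | inj₁ p with _ , q , refl ← ∈-map⁻ (outside ∷_) p = old q
... | inj₂ p with _ , q , refl ← ∈-map⁻ (inside ∷_) p = new q

extremal-min : ∀ k n {U} → U ∈ˡ extremal k n → ∃ (Min U)
extremal-min k (suc n) U∈ with view k n U∈
... | old p with x , m ← extremal-min k n p = suc x , min-∷ m
... | new p = zero , hereᵛ , λ _ → z≤n

-- In the mixed case the tail of `V` contains the minimum of `U` and is closed upwards, so it
-- contains all of `U`. Two sets with minimum `zero` are comparable because tails form a chain.
min-comparable : ∀ k n {U V x} → U ∈ˡ extremal k n → V ∈ˡ extremal k n →
  Min U x → x ∈ V → V ⊆ U ⊎ U ⊆ V
min-comparable k (suc n) U∈ V∈ m x∈V with view k n U∈ | view k n V∈
min-comparable k (suc n) _ _ m@(thereᵛ _ , _) (thereᵛ x∈V) | old p | old q =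
  Sum.map s⊆s s⊆s (min-comparable k n p q (min-drop m) x∈V)
min-comparable k (suc n) _ _ m@(thereᵛ _ , _) (thereᵛ x∈V) | old p | new q =
  inj₂ (out⊆ λ y∈ → tails-upClosed k n q (proj₂ (min-drop m) y∈) x∈V)
min-comparable k (suc n) _ _ (_ , x≤) (thereᵛ _) | new _ | old _ with () ← x≤ hereᵛ
min-comparable k (suc n) _ _ _ _ | new p | new q = Sum.map s⊆s s⊆s (tails-total k n q p)

min-window : ∀ k n {U V a b x} → U ∈ˡ extremal k n → V ∈ˡ extremal k n → Min U a → Min V b →
  x ∈ U → x ∈ V → a Fin.< b → V ⊆ U ⊎ toℕ b < toℕ a + k
min-window k (suc n) {b = suc b} U∈ V∈ mU mV x∈U x∈V a<b with view k n U∈ | view k n V∈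
min-window k (suc n) {b = suc b} _ _ _ (_ , b≤) _ _ _ | _ | new _ with () ← b≤ hereᵛ
min-window k (suc n) {b = suc b} _ _ mU@(thereᵛ _ , _) mV (thereᵛ x∈U) (thereᵛ x∈V) (s≤s a<b)
  | old p | old q =
  Sum.map s⊆s s≤s (min-window k n p q (min-drop mU) (min-drop mV) x∈U x∈V a<b)
min-window k (suc n) {a = suc _} {suc b} _ _ (_ , a≤) _ _ _ _ | new _ | old _ with () ← a≤ hereᵛ
min-window k (suc n) {U = _ ∷ U} {a = zero} {suc b} _ _ _ mV (thereᵛ x∈U) (thereᵛ _) _
  | new p | old _ with b ∈? U
-- The minimum of `V` is `suc b`. If the tail of `U` contains `b`, it contains all of `V`; otherwise
-- `tails-gap` bounds `suc b` by `k`, and `a` is `zero`.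
... | yes b∈ = inj₁ (out⊆ λ y∈ → tails-upClosed k n p (proj₂ (min-drop mV) y∈) b∈)
... | no b∉  = inj₂ (tails-gap k n p x∈U b∉)

-- Local width through residues, and the pseudotree axioms.

-- With equal remainders, `a < b` makes the quotient of `b` the larger one, so `b` is at least
-- `a + k`.
%-injective-window : ∀ {a b k} .{{_ : NonZero k}} → a < b → b < a + k → a % k ≢ b % k
%-injective-window {a} {b} {k} a<b b<a+k eq = <⇒≱ b<a+k (begin
  a + k                     ≡⟨ cong (_+ k) (m≡m%n+[m/n]*n a k) ⟩
  a % k + a / k * k + k     ≡⟨ +-assoc (a % k) _ k ⟩
  a % k + (a / k * k + k)   ≡⟨ cong (a % k +_) (+-comm _ k) ⟩
  a % k + suc (a / k) * k   ≤⟨ +-monoʳ-≤ (a % k) (*-monoˡ-≤ k a/k<b/k) ⟩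
  a % k + b / k * k         ≡⟨ b≡ ⟨
  b                         ∎)
  where
  open ≤-Reasoning
  b≡ : b ≡ a % k + b / k * k
  b≡ = trans (m≡m%n+[m/n]*n b k) (cong (_+ b / k * k) (sym eq))

  a/k<b/k : a / k < b / k
  a/k<b/k = *-cancelʳ-< k _ _ (+-cancelˡ-< (a % k) _ _
    (subst (_< a % k + b / k * k) (m≡m%n+[m/n]*n a k) (subst (a <_) b≡ a<b)))

Extremal-pseudotree : ∀ n k → IsPseudotree (suc k) (Extremal (suc k) (suc n))
Extremal-pseudotree n k = record
  { centered    = λ U U∈ → let x , m = extremal-min (suc k) (suc n) U∈ in
      x , proj₁ m , λ V V∈ x∈V → min-comparable (suc k) (suc n) U∈ V∈ m x∈V
  ; locallyWide = locallyWide
  ; whole       = ∈-++⁺ʳ (map (outside ∷_) (extremal (suc k) n)) (∈-map⁺ _ (⊤∈tails k n))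
  ; singletons  = singletons (suc n)
  }
  where
  singletons : ∀ n x → ⁅ x ⁆ ∈ˡ extremal (suc k) n
  singletons (suc n) zero    = ∈-++⁺ʳ (map (outside ∷_) (extremal (suc k) n))
    (∈-map⁺ _ (⊥∈tails (suc k) n))
  singletons (suc n) (suc x) = ∈-++⁺ˡ (∈-map⁺ _ (singletons n x))

  locallyWide : LocallyWide (suc k) (Extremal (suc k) (suc n))
  -- Minima in a window of length suc k are separated by their residues modulo suc k.
  locallyWide x G G-sub antichain = unique-length≤ residue (unique G) choose same
    where
    residue : Subset (suc n) → Fin (suc k) → Set
    residue U i = ∃ λ a → Min U a × toℕ a % suc k ≡ toℕ i

    choose : ∀ {U} → U ∈ᶠ G → ∃ (residue U)
    choose U∈ with a , m ← extremal-min (suc k) (suc n) (proj₁ (G-sub _ U∈)) =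
      fromℕ< (m%n<n (toℕ a) (suc k)) , a , m , sym (toℕ-fromℕ< _)

    same-min : ∀ {U V a b} → U ∈ᶠ G → V ∈ᶠ G → Min U a → Min V b →
      toℕ a % suc k ≡ toℕ b % suc k → a Fin.< b → U ≡ V
    same-min U∈ V∈ mU mV eq a<b
      with min-window (suc k) (suc n) (proj₁ (G-sub _ U∈)) (proj₁ (G-sub _ V∈)) mU mV
             (proj₂ (G-sub _ U∈)) (proj₂ (G-sub _ V∈)) a<b
    ... | inj₁ V⊆U = sym (antichain _ _ V∈ U∈ V⊆U)
    ... | inj₂ b<  = contradiction eq (%-injective-window a<b b<)

    same : ∀ {U V i} → U ∈ᶠ G → V ∈ᶠ G → residue U i → residue V i → U ≡ V
    same {U} {V} U∈ V∈ (a , mU , p) (b , mV , q) with <-cmp (toℕ a) (toℕ b)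
    ... | tri< a<b _ _ = same-min U∈ V∈ mU mV (trans p (sym q)) a<b
    ... | tri> _ _ b<a = sym (same-min V∈ U∈ mV mU (trans q (sym p)) b<a)
    -- Members with the same minimum are comparable, so the antichain identifies them.
    ... | tri≈ _ a≡b _ = [ sym ∘ antichain V U V∈ U∈ , antichain U V U∈ V∈ ]′
      (min-comparable (suc k) (suc n) (proj₁ (G-sub U U∈)) (proj₁ (G-sub V V∈)) mU
        (subst (_∈ V) (sym (toℕ-injective a≡b)) (proj₁ mV)))

-- Closed form of the sum.

-- The triangular numbers, defined without division so that the halving in `bound` is seen to be
-- exact.
tri : ℕ → ℕ
tri zero    = 0
tri (suc k) = tri k + suc k

tri*2 : ∀ k → (k + 1) * k ≡ tri k * 2
tri*2 zero    = refl
tri*2 (suc k) = begin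
  (suc k + 1) * suc k     ≡⟨ solve 1 (λ k → (con 1 :+ k :+ con 1) :* (con 1 :+ k)
                               := (k :+ con 1) :* k :+ (con 1 :+ k) :* con 2) refl k ⟩
  (k + 1) * k + suc k * 2 ≡⟨ cong (_+ suc k * 2) (tri*2 k) ⟩
  tri k * 2 + suc k * 2   ≡⟨ *-distribʳ-+ 2 (tri k) (suc k) ⟨
  tri (suc k) * 2         ∎
  where
  open ≡-Reasoning
  open +-*-Solver

total-≤ : ∀ n k → n ≤ k → total n k ≡ tri n
total-≤ zero    k _   = refl
total-≤ (suc n) k n<k = cong₂ _+_ (total-≤ n k (<⇒≤ n<k)) (cong suc (m≤n⇒m⊓n≡m (<⇒≤ n<k)))

-- The first `k` summands add up to `tri k` and each of the other `d` is `k + 1`. Adding `tri k` on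
-- the left avoids truncated subtraction.
total+tri : ∀ d k → total (d + k) k + tri k ≡ (k + 1) * (d + k)
total+tri zero    k = begin
  total k k + tri k ≡⟨ cong (_+ tri k) (total-≤ k k ≤-refl) ⟩
  tri k + tri k     ≡⟨ solve 1 (λ t → t :+ t := t :* con 2) refl (tri k) ⟩
  tri k * 2         ≡⟨ tri*2 k ⟨
  (k + 1) * k       ∎
  where
  open ≡-Reasoning
  open +-*-Solver
total+tri (suc d) k = begin
  total (d + k) k + suc ((d + k) ⊓ k) + tri k
    ≡⟨ cong (λ m → total (d + k) k + suc m + tri k) (m≥n⇒m⊓n≡n (m≤n+m k d)) ⟩
  total (d + k) k + suc k + tri k
    ≡⟨ solve 3 (λ s k t → s :+ (con 1 :+ k) :+ t := s :+ t :+ (con 1 :+ k)) refl (total (d + k) k) k (tri k) ⟩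
  total (d + k) k + tri k + suc k
    ≡⟨ cong (_+ suc k) (total+tri d k) ⟩
  (k + 1) * (d + k) + suc k
    ≡⟨ solve 2 (λ k m → (k :+ con 1) :* m :+ (con 1 :+ k) := (k :+ con 1) :* (con 1 :+ m)) refl k (d + k) ⟩
  (k + 1) * suc (d + k) ∎
  where
  open ≡-Reasoning
  open +-*-Solver

total≡bound : ∀ {n k} → k ≤ n → total n k ≡ bound n k
total≡bound {n} {k} k≤n = sym (begin
  (k + 1) * n ∸ (k + 1) * k / 2 ≡⟨ cong₂ _∸_ (sym total+tri′) (trans (cong (_/ 2) (tri*2 k)) (m*n/n≡m (tri k) 2)) ⟩
  total n k + tri k ∸ tri k     ≡⟨ m+n∸n≡m (total n k) (tri k) ⟩
  total n k                     ∎)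
  where
  open ≡-Reasoning
  total+tri′ : total n k + tri k ≡ (k + 1) * n
  total+tri′ = subst (λ n → total n k + tri k ≡ (k + 1) * n) (m∸n+n≡m k≤n) (total+tri (n ∸ k) k)

theorem3p4p1 : ∀ (n k : ℕ) → 1 ≤ k → k < n →
    (∀ (F : Family n) → IsPseudotree k F → size F ≤ bound n k)
    × (∃[ F ] (IsPseudotree {n} k F × size F ≡ bound n k))
theorem3p4p1 n@(suc m) k@(suc j) _ k<n =
  (λ F p → subst (size F ≤_) (total≡bound (<⇒≤ k<n))
    (size≤total F (IsPseudotree.centered p) (IsPseudotree.locallyWide p))) ,
  Extremal k n , Extremal-pseudotree m j , trans (size-Extremal k n) (total≡bound (<⇒≤ k<n))
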